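{- For all integers $n\ge0$, one has $a(12n+11)\equiv 0\pmod 3$.
   Context: For a positive integer $n$, $a(n)$ is the signed number of partitions of $n$ into exactly two distinct part sizes, each occurring an odd number of times: $$a(n)=\sum (-1)^{r_1+r_2},$$ the sum being over all quadruples of integers $(x,y,r_1,r_2)$ with $1\le x<y$, $r_1,r_2\ge 0$ and $(2r_1+1)x+(2r_2+1)y=n$. -}

module Defs where

open import Data.Nat using (ℕ; suc; _+_; _*_; _≤_; _<_; s≤s; _≤?_; _<?_; _≟_; >-nonZero)
open import Data.Nat.Properties using (≤-trans; <⇒≤; m≤m+n; m≤n+m; m≤m*n; +-comm)
open import Data.Integer as ℤ using (ℤ; 0ℤ; -1ℤ)
open import Data.List using (List; map; foldr; filter; upTo; cartesianProduct)
open import Data.List.Membership.Propositional using (_∈_)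
open import Data.List.Membership.Propositional.Properties using (∈-cartesianProduct⁺; ∈-upTo⁺; ∈-filter⁺; ∈-filter⁻)
open import Data.List.Relation.Unary.Unique.Propositional using (Unique)
import Data.List.Relation.Unary.Unique.Propositional.Properties as Uniqueₚ
open import Data.Product using (_×_; _,_; proj₂)
open import Function.Bundles using (_⇔_; mk⇔)
open import Relation.Binary.PropositionalEquality using (_≡_; refl)
open import Relation.Nullary.Decidable using (Dec; _×-dec_)

-- (x , y , r₁ , r₂)
Quadruple : Set
Quadruple = ℕ × ℕ × ℕ × ℕ

Admissible : ℕ → Quadruple → Set
Admissible n (x , y , r₁ , r₂) =
  1 ≤ x × x < y × (2 * r₁ + 1) * x + (2 * r₂ + 1) * y ≡ n

admissible? : ∀ n q → Dec (Admissible n q)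
admissible? n (x , y , r₁ , r₂) =
  (1 ≤? x) ×-dec (x <? y) ×-dec ((2 * r₁ + 1) * x + (2 * r₂ + 1) * y ≟ n)

box : ℕ → List Quadruple
box n = cartesianProduct I (cartesianProduct I (cartesianProduct I I))
  where I = upTo (suc n)

-- Every entry of an admissible quadruple is at most n, so searching [0, n]⁴
-- loses nothing: see ∈-quadruples and quadruples-unique.
quadruples : ℕ → List Quadruple
quadruples n = filter (admissible? n) (box n)

sign : Quadruple → ℤ
sign (x , y , r₁ , r₂) = -1ℤ ℤ.^ (r₁ + r₂)

a : ℕ → ℤ
a n = foldr ℤ._+_ 0ℤ (map sign (quadruples n))

quadruples-unique : ∀ n → Unique (quadruples n)
quadruples-unique n = Uniqueₚ.filter⁺ (admissible? n)
  (Uniqueₚ.cartesianProduct⁺ u (Uniqueₚ.cartesianProduct⁺ u (Uniqueₚ.cartesianProduct⁺ u u)))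
  where u = Uniqueₚ.upTo⁺ (suc n)

∈-quadruples : ∀ n q → q ∈ quadruples n ⇔ Admissible n q
∈-quadruples n q = mk⇔ (λ q∈ → proj₂ (∈-filter⁻ (admissible? n) {xs = box n} q∈)) (complete q)
  where
  part≤ : ∀ r z → z ≤ (2 * r + 1) * z
  part≤ r z rewrite +-comm (2 * r) 1 = m≤m+n z _

  mult≤ : ∀ r z → 1 ≤ z → r ≤ (2 * r + 1) * z
  mult≤ r z 1≤z = ≤-trans (≤-trans (m≤m+n r _) (m≤m+n (2 * r) 1))
    (m≤m*n (2 * r + 1) z {{>-nonZero 1≤z}})

  complete : ∀ q → Admissible n q → q ∈ quadruples n
  complete (x , y , r₁ , r₂) adm@(1≤x , x<y , refl) = ∈-filter⁺ (admissible? n)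
    (∈-cartesianProduct⁺ (left (part≤ r₁ x)) (∈-cartesianProduct⁺ (right (part≤ r₂ y))
      (∈-cartesianProduct⁺ (left (mult≤ r₁ x 1≤x)) (right (mult≤ r₂ y (≤-trans 1≤x (<⇒≤ x<y)))))))
    adm
    where
    left : ∀ {i} → i ≤ (2 * r₁ + 1) * x → i ∈ upTo (suc n)
    left i≤ = ∈-upTo⁺ (s≤s (≤-trans i≤ (m≤m+n _ _)))

    right : ∀ {i} → i ≤ (2 * r₂ + 1) * y → i ∈ upTo (suc n)
    right i≤ = ∈-upTo⁺ (s≤s (≤-trans i≤ (m≤n+m _ _)))

{-# OPTIONS --safe #-}
module Submission where

-- Put χ(m) = sin(πm/2) and κ(m) = cos(πm/2).  For odd n, a(n) is the sum of
-- χ(k)χ(l) over the positive solutions of k x + l y = n with x < y.  Following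
-- Liouville, the shear (k, l, x, y) ↦ (k + l, l, x, y - x) maps the solutions
-- with x < y bijectively onto those with l < k; by the addition formulas it
-- turns χ(k)χ(l) into -κ(k), and κ(k) into χ(k)χ(l).  Splitting the sums of
-- χ(k)χ(l) and of κ(k) over all solutions once by comparing x with y and once
-- by comparing k with l then leaves only diagonal terms:
--   4 a(n) = Σ_{(k + l) x = n} (1 - 2κ(k)) = Σ_{d x = n} (d - χ(d)).
-- If n ≡ 11 (mod 12), exchanging d and x makes χ(d) + χ(x) = 0 and
-- d + x ≡ 0 (mod 3), so the last sum is divisible by 3.

open import Defs
open import Data.Nat using (ℕ; _+_; _*_)
open import Data.Integer using (+_)
open import Data.Integer.Divisibility using (_∣_)

open import Data.Empty using (⊥-elim)
import Data.Fin as Fin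
open import Data.Integer as ℤ using (ℤ; 0ℤ; 1ℤ; -1ℤ)
import Data.Integer.Divisibility.Signed as Signed
import Data.Integer.Properties as ℤₚ
open import Data.Integer.Tactic.RingSolver using (solve-∀)
open import Data.List using (List; []; _∷_; _++_; map; foldr; filter; downFrom; cartesianProduct)
import Data.List.Properties as Listₚ
open import Data.List.Membership.Propositional using (_∈_)
open import Data.List.Membership.Propositional.Properties using (∈-map⁺; ∈-map⁻; ∈-filter⁺; ∈-filter⁻; ∈-cartesianProduct⁺; ∈-cartesianProduct⁻; ∈-downFrom⁺; ∈-downFrom⁻)
open import Data.List.Membership.Propositional.Properties.WithK using (unique∧set⇒bag)
open import Data.List.Relation.Binary.BagAndSetEquality using (∼bag⇒↭)
open import Data.List.Relation.Binary.Permutation.Propositional using (_↭_; ↭⇒↭ₛ)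
import Data.List.Relation.Binary.Permutation.Propositional.Properties as Permutationₚ
import Data.List.Relation.Binary.Permutation.Setoid.Properties as Permutationₛ
import Data.List.Relation.Unary.All as All
import Data.List.Relation.Unary.All.Properties as Allₚ
open import Data.List.Relation.Unary.AllPairs using ([]; _∷_)
open import Data.List.Relation.Unary.Any using (here; there)
open import Data.List.Relation.Unary.Unique.Propositional using (Unique)
import Data.List.Relation.Unary.Unique.Propositional.Properties as Uniqueₚ
open import Data.Nat using (zero; suc; pred; ⌊_/2⌋; _≤_; _<_; _∸_; z≤n; s≤s; _≤?_; _<?_; _≟_; >-nonZero)
import Data.Nat.DivMod as DivMod
import Data.Nat.Divisibility as ℕ∣
import Data.Nat.Properties as ℕₚ
import Data.Nat.Tactic.RingSolver as ℕ-solver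
open import Data.Product using (_×_; _,_; proj₁; proj₂; ∃)
open import Data.Sum using (_⊎_; inj₁; inj₂; [_,_]′)
open import Function using (_∘_; id)
open import Function.Bundles using (mk⇔; Equivalence)
open import Relation.Binary.Definitions using (Tri; tri<; tri≈; tri>)
open import Relation.Binary.PropositionalEquality using (_≡_; refl; sym; trans; cong; cong₂; subst; setoid; module ≡-Reasoning)
open import Relation.Nullary using (¬_; yes; no)
open import Relation.Nullary.Decidable using (_×-dec_)
open import Relation.Unary using (Decidable)
open import Algebra.Properties.AbelianGroup ℤₚ.+-0-abelianGroup using () renaming (∙-cancelʳ to +-cancelʳ)

private
  variable
    A B : Set
    P Q R : A → Set

-- Finite sums

∑ : List A → (A → ℤ) → ℤ
∑ xs w = foldr ℤ._+_ 0ℤ (map w xs)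

+-congˡ : ∀ i {j k} → j ≡ k → i ℤ.+ j ≡ i ℤ.+ k
+-congˡ i = cong (λ j → i ℤ.+ j)

∑-cong : (xs : List A) {v w : A → ℤ} → (∀ {x} → x ∈ xs → v x ≡ w x) → ∑ xs v ≡ ∑ xs w
∑-cong []       v≡w = refl
∑-cong (x ∷ xs) v≡w = cong₂ ℤ._+_ (v≡w (here refl)) (∑-cong xs (v≡w ∘ there))

∑-0 : (xs : List A) {w : A → ℤ} → (∀ {x} → x ∈ xs → w x ≡ 0ℤ) → ∑ xs w ≡ 0ℤ
∑-0 []       w≡0 = refl
∑-0 (x ∷ xs) w≡0 = cong₂ ℤ._+_ (w≡0 (here refl)) (∑-0 xs (w≡0 ∘ there))

∑-distrib-+ : (xs : List A) (v w : A → ℤ) → ∑ xs (λ x → v x ℤ.+ w x) ≡ ∑ xs v ℤ.+ ∑ xs w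
∑-distrib-+ []       v w = refl
∑-distrib-+ (x ∷ xs) v w =
  trans (+-congˡ (v x ℤ.+ w x) (∑-distrib-+ xs v w)) (interchange (v x) (w x) (∑ xs v) (∑ xs w))
  where
  interchange : ∀ i j k l → (i ℤ.+ j) ℤ.+ (k ℤ.+ l) ≡ (i ℤ.+ k) ℤ.+ (j ℤ.+ l)
  interchange = solve-∀

∑-distrib-* : (xs : List A) (c : ℤ) (w : A → ℤ) → ∑ xs (λ x → c ℤ.* w x) ≡ c ℤ.* ∑ xs w
∑-distrib-* []       c w = sym (ℤₚ.*-zeroʳ c)
∑-distrib-* (x ∷ xs) c w =
  trans (+-congˡ (c ℤ.* w x) (∑-distrib-* xs c w)) (sym (ℤₚ.*-distribˡ-+ c (w x) (∑ xs w)))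

∑-∣ : (k : ℤ) (xs : List A) {w : A → ℤ} → (∀ {x} → x ∈ xs → k Signed.∣ w x) → k Signed.∣ ∑ xs w
∑-∣ k []       k∣w = Signed.divides 0ℤ refl
∑-∣ k (x ∷ xs) k∣w = Signed.∣m∣n⇒∣m+n (k∣w (here refl)) (∑-∣ k xs (k∣w ∘ there))

∑-++ : (xs ys : List A) (w : A → ℤ) → ∑ (xs ++ ys) w ≡ ∑ xs w ℤ.+ ∑ ys w
∑-++ []       ys w = sym (ℤₚ.+-identityˡ _)
∑-++ (x ∷ xs) ys w = trans (+-congˡ (w x) (∑-++ xs ys w)) (sym (ℤₚ.+-assoc (w x) _ _))

∑-map : (f : A → B) (xs : List A) (w : B → ℤ) → ∑ (map f xs) w ≡ ∑ xs (w ∘ f)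
∑-map f xs w = cong (foldr ℤ._+_ 0ℤ) (sym (Listₚ.map-∘ xs))

∑-↭ : {xs ys : List A} (w : A → ℤ) → xs ↭ ys → ∑ xs w ≡ ∑ ys w
∑-↭ w xs↭ys =
  Permutationₛ.foldr-commMonoid (setoid ℤ) ℤₚ.+-0-isCommutativeMonoid (↭⇒↭ₛ (Permutationₚ.map⁺ w xs↭ys))

∑-filter-restrict : (P? : Decidable P) (xs : List A) {w : A → ℤ} →
  (∀ x → ¬ P x → w x ≡ 0ℤ) → ∑ xs w ≡ ∑ (filter P? xs) w
∑-filter-restrict P? []       w≡0 = refl
∑-filter-restrict P? (x ∷ xs) {w} w≡0 with P? x
... | yes _  = +-congˡ (w x) (∑-filter-restrict P? xs w≡0)
... | no ¬Px = trans (cong₂ ℤ._+_ (w≡0 x ¬Px) (∑-filter-restrict P? xs w≡0)) (ℤₚ.+-identityˡ _)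

-- `Tri` refutes the two alternatives that fail as well as proving the third, so each element
-- survives in exactly one of the filtered lists.
∑-trichotomy : (P? : Decidable P) (Q? : Decidable Q) (R? : Decidable R) → (∀ x → Tri (P x) (Q x) (R x)) →
  (xs : List A) (w : A → ℤ) →
  ∑ xs w ≡ ∑ (filter P? xs) w ℤ.+ ∑ (filter Q? xs) w ℤ.+ ∑ (filter R? xs) w
∑-trichotomy P? Q? R? cmp []       w = refl
∑-trichotomy P? Q? R? cmp (x ∷ xs) w with cmp x
... | tri< p ¬q ¬r
  rewrite Listₚ.filter-accept P? {xs = xs} p | Listₚ.filter-reject Q? {xs = xs} ¬q | Listₚ.filter-reject R? {xs = xs} ¬r
  = trans (+-congˡ (w x) (∑-trichotomy P? Q? R? cmp xs w)) (rearrange (w x) (∑ (filter P? xs) w) _ _)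
  where
  rearrange : ∀ i j k l → i ℤ.+ (j ℤ.+ k ℤ.+ l) ≡ (i ℤ.+ j) ℤ.+ k ℤ.+ l
  rearrange = solve-∀
... | tri≈ ¬p q ¬r
  rewrite Listₚ.filter-reject P? {xs = xs} ¬p | Listₚ.filter-accept Q? {xs = xs} q | Listₚ.filter-reject R? {xs = xs} ¬r
  = trans (+-congˡ (w x) (∑-trichotomy P? Q? R? cmp xs w)) (rearrange (w x) (∑ (filter P? xs) w) _ _)
  where
  rearrange : ∀ i j k l → i ℤ.+ (j ℤ.+ k ℤ.+ l) ≡ j ℤ.+ (i ℤ.+ k) ℤ.+ l
  rearrange = solve-∀
... | tri> ¬p ¬q r
  rewrite Listₚ.filter-reject P? {xs = xs} ¬p | Listₚ.filter-reject Q? {xs = xs} ¬q | Listₚ.filter-accept R? {xs = xs} r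
  = trans (+-congˡ (w x) (∑-trichotomy P? Q? R? cmp xs w)) (rearrange (w x) (∑ (filter P? xs) w) _ _)
  where
  rearrange : ∀ i j k l → i ℤ.+ (j ℤ.+ k ℤ.+ l) ≡ j ℤ.+ k ℤ.+ (i ℤ.+ l)
  rearrange = solve-∀

∑-filter-map : (f : A → B) (P? : Decidable P) (xs : List A) (w : B → ℤ) →
  ∑ (filter P? (map f xs)) w ≡ ∑ (filter (P? ∘ f) xs) (w ∘ f)
∑-filter-map f P? []       w = refl
∑-filter-map f P? (x ∷ xs) w with P? (f x)
... | yes _ = +-congˡ (w (f x)) (∑-filter-map f P? xs w)
... | no _  = ∑-filter-map f P? xs w

-- Lets the range of the inner variable depend on the outer one, as k < d does for a factorization d
-- x = n.
∑-filter-cartesianProduct : {P : A × B → Set} (P? : Decidable P) (xs : List A) (ys : List B) (w : A × B → ℤ) →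
  ∑ (filter P? (cartesianProduct xs ys)) w ≡ ∑ xs (λ x → ∑ (filter (λ y → P? (x , y)) ys) (λ y → w (x , y)))
∑-filter-cartesianProduct P? []       ys w = refl
∑-filter-cartesianProduct P? (x ∷ xs) ys w = begin
  ∑ (filter P? (map (x ,_) ys ++ cartesianProduct xs ys)) w
    ≡⟨ cong (λ zs → ∑ zs w) (Listₚ.filter-++ P? (map (x ,_) ys) _) ⟩
  ∑ (filter P? (map (x ,_) ys) ++ filter P? (cartesianProduct xs ys)) w
    ≡⟨ ∑-++ (filter P? (map (x ,_) ys)) _ w ⟩
  ∑ (filter P? (map (x ,_) ys)) w ℤ.+ ∑ (filter P? (cartesianProduct xs ys)) w
    ≡⟨ cong₂ ℤ._+_ (∑-filter-map (x ,_) P? ys w) (∑-filter-cartesianProduct P? xs ys w) ⟩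
  _ ∎
  where open ≡-Reasoning

-- Duplicate-free enumerations of predicates

-- Duplicate-free lists with the same members are permutations of each other, so a sum over `list`
-- depends on `P` alone. Identities between sums thus reduce to bijections between sets of
-- solutions.
record Enumeration {A : Set} (P : A → Set) : Set where
  field
    list     : List A
    unique   : Unique list
    sound    : ∀ {x} → x ∈ list → P x
    complete : ∀ {x} → P x → x ∈ list

open Enumeration

restrict : Enumeration P → Decidable Q → Enumeration (λ x → P x × Q x)
restrict E Q? .list     = filter Q? (E .list)
restrict E Q? .unique   = Uniqueₚ.filter⁺ Q? (E .unique)
restrict E Q? .sound    x∈ with ∈-filter⁻ Q? {xs = E .list} x∈
... | x∈E , Qx = E .sound x∈E , Qx
restrict E Q? .complete (Px , Qx) = ∈-filter⁺ Q? (E .complete Px) Qx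

reindex : Enumeration P → (∀ {x} → P x → Q x) → (∀ {x} → Q x → P x) → Enumeration Q
reindex E P⇒Q Q⇒P .list     = E .list
reindex E P⇒Q Q⇒P .unique   = E .unique
reindex E P⇒Q Q⇒P .sound    = P⇒Q ∘ E .sound
reindex E P⇒Q Q⇒P .complete = E .complete ∘ Q⇒P

below : ∀ n → Enumeration (_< n)
below n .list     = downFrom n
below n .unique   = Uniqueₚ.downFrom⁺ n
below n .sound    = ∈-downFrom⁻
below n .complete = ∈-downFrom⁺

product : {P : A → Set} {Q : B → Set} → Enumeration P → Enumeration Q → Enumeration (λ (x , y) → P x × Q y)
product E F .list     = cartesianProduct (E .list) (F .list)
product E F .unique   = Uniqueₚ.cartesianProduct⁺ (E .unique) (F .unique)
product E F .sound    xy∈ with ∈-cartesianProduct⁻ (E .list) (F .list) xy∈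
... | x∈ , y∈ = E .sound x∈ , F .sound y∈
product E F .complete (Px , Qy) = ∈-cartesianProduct⁺ (E .complete Px) (F .complete Qy)

-- Injectivity is asked on members of `xs` only: `shear`, with its truncated subtraction, is not
-- injective on all quadruples.
unique-map : {f : A → B} {xs : List A} →
  (∀ {x y} → x ∈ xs → y ∈ xs → f x ≡ f y → x ≡ y) → Unique xs → Unique (map f xs)
unique-map inj []            = []
unique-map inj (x∉ ∷ xs-unq) =
  Allₚ.map⁺ (All.tabulate λ y∈ fx≡fy → All.lookup x∉ y∈ (inj (here refl) (there y∈) fx≡fy))
  ∷ unique-map (λ x∈ y∈ → inj (there x∈) (there y∈)) xs-unq

-- The image of one list under `f` is duplicate-free, as `g` inverts `f` there, and has the members
-- of the other list; equal sets without duplicates are equal bags, hence permutations.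
∑-bijection : {P : A → Set} {Q : B → Set} (E : Enumeration P) (F : Enumeration Q)
  (f : A → B) (g : B → A) →
  (∀ x → P x → Q (f x) × g (f x) ≡ x) → (∀ y → Q y → P (g y) × f (g y) ≡ y) →
  (w : B → ℤ) → ∑ (E .list) (w ∘ f) ≡ ∑ (F .list) w
∑-bijection E F f g to from w = begin
  ∑ (E .list) (w ∘ f)    ≡⟨ ∑-map f (E .list) w ⟨
  ∑ (map f (E .list)) w  ≡⟨ ∑-↭ w (∼bag⇒↭ (unique∧set⇒bag f-unique (F .unique) (mk⇔ ⊆F F⊆))) ⟩
  ∑ (F .list) w          ∎
  where
  open ≡-Reasoning
  injective : ∀ {x y} → x ∈ E .list → y ∈ E .list → f x ≡ f y → x ≡ y
  injective x∈ y∈ fx≡fy =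
    trans (sym (proj₂ (to _ (E .sound x∈)))) (trans (cong g fx≡fy) (proj₂ (to _ (E .sound y∈))))

  f-unique : Unique (map f (E .list))
  f-unique = unique-map injective (E .unique)

  ⊆F : ∀ {y} → y ∈ map f (E .list) → y ∈ F .list
  ⊆F y∈ with ∈-map⁻ f y∈
  ... | x , x∈ , refl = F .complete (proj₁ (to x (E .sound x∈)))

  F⊆ : ∀ {y} → y ∈ F .list → y ∈ map f (E .list)
  F⊆ {y} y∈ with from y (F .sound y∈)
  ... | Pgy , fgy≡y = subst (_∈ map f (E .list)) fgy≡y (∈-map⁺ f (E .complete Pgy))

-- The quarter-period sine χ and cosine κ

-- The recursion is a quarter turn, and `χ` is the nonprincipal Dirichlet character modulo 4. Parity
-- is expressed by vanishing: `χ m ≡ 0ℤ` for even `m`, `κ m ≡ 0ℤ` for odd `m`.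
χ κ : ℕ → ℤ
χ zero    = 0ℤ
χ (suc m) = κ m
κ zero    = 1ℤ
κ (suc m) = ℤ.- χ m

-- Joint induction: by the quarter turn, each formula at `suc m` is the other one at `m`, up to
-- sign.
χ-+ : ∀ m n → χ (m + n) ≡ χ m ℤ.* κ n ℤ.+ κ m ℤ.* χ n
κ-+ : ∀ m n → κ (m + n) ≡ κ m ℤ.* κ n ℤ.- χ m ℤ.* χ n
χ-+ zero    n = zero-case (χ n) (κ n)
  where
  zero-case : ∀ i j → i ≡ 0ℤ ℤ.* j ℤ.+ 1ℤ ℤ.* i
  zero-case = solve-∀
χ-+ (suc m) n = trans (κ-+ m n) (negate (χ m) (κ m) (χ n) (κ n))
  where
  negate : ∀ i j k l → j ℤ.* l ℤ.- i ℤ.* k ≡ j ℤ.* l ℤ.+ (ℤ.- i) ℤ.* k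
  negate = solve-∀
κ-+ zero    n = zero-case (χ n) (κ n)
  where
  zero-case : ∀ i j → j ≡ 1ℤ ℤ.* j ℤ.- 0ℤ ℤ.* i
  zero-case = solve-∀
κ-+ (suc m) n = trans (cong ℤ.-_ (χ-+ m n)) (negate (χ m) (κ m) (χ n) (κ n))
  where
  negate : ∀ i j k l → ℤ.- (i ℤ.* l ℤ.+ j ℤ.* k) ≡ (ℤ.- i) ℤ.* l ℤ.- j ℤ.* k
  negate = solve-∀

χ²+κ²≡1 : ∀ m → χ m ℤ.* χ m ℤ.+ κ m ℤ.* κ m ≡ 1ℤ
χ²+κ²≡1 zero    = refl
χ²+κ²≡1 (suc m) = trans (rotate (χ m) (κ m)) (χ²+κ²≡1 m)
  where
  rotate : ∀ i j → j ℤ.* j ℤ.+ (ℤ.- i) ℤ.* (ℤ.- i) ≡ i ℤ.* i ℤ.+ j ℤ.* j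
  rotate = solve-∀

χ≡0⊎κ≡0 : ∀ m → χ m ≡ 0ℤ ⊎ κ m ≡ 0ℤ
χ≡0⊎κ≡0 zero    = inj₁ refl
χ≡0⊎κ≡0 (suc m) = [ (λ χ≡0 → inj₂ (cong ℤ.-_ χ≡0)) , inj₁ ]′ (χ≡0⊎κ≡0 m)

χκ≡0 : ∀ m → χ m ℤ.* κ m ≡ 0ℤ
χκ≡0 m with χ≡0⊎κ≡0 m
... | inj₁ χ≡0 = cong (ℤ._* κ m) χ≡0
... | inj₂ κ≡0 = trans (cong (χ m ℤ.*_) κ≡0) (ℤₚ.*-zeroʳ (χ m))

κ≡0⇒χ²≡1 : ∀ m → κ m ≡ 0ℤ → χ m ℤ.* χ m ≡ 1ℤ
κ≡0⇒χ²≡1 m κ≡0 = begin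
  χ m ℤ.* χ m                    ≡⟨ ℤₚ.+-identityʳ _ ⟨
  χ m ℤ.* χ m ℤ.+ 0ℤ ℤ.* 0ℤ      ≡⟨ cong (λ i → χ m ℤ.* χ m ℤ.+ i ℤ.* i) κ≡0 ⟨
  χ m ℤ.* χ m ℤ.+ κ m ℤ.* κ m    ≡⟨ χ²+κ²≡1 m ⟩
  1ℤ                             ∎
  where open ≡-Reasoning

χ≡0-+ : ∀ m n → χ m ≡ 0ℤ → χ n ≡ 0ℤ → χ (m + n) ≡ 0ℤ
χ≡0-+ m n χm≡0 χn≡0 = begin
  χ (m + n)                        ≡⟨ χ-+ m n ⟩
  χ m ℤ.* κ n ℤ.+ κ m ℤ.* χ n      ≡⟨ cong₂ (λ i j → i ℤ.* κ n ℤ.+ κ m ℤ.* j) χm≡0 χn≡0 ⟩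
  0ℤ ℤ.* κ n ℤ.+ κ m ℤ.* 0ℤ        ≡⟨ cong₂ ℤ._+_ (ℤₚ.*-zeroˡ (κ n)) (ℤₚ.*-zeroʳ (κ m)) ⟩
  0ℤ                               ∎
  where open ≡-Reasoning

κ≡0-+ : ∀ m n → κ m ≡ 0ℤ → κ n ≡ 0ℤ → χ (m + n) ≡ 0ℤ
κ≡0-+ m n κm≡0 κn≡0 = begin
  χ (m + n)                        ≡⟨ χ-+ m n ⟩
  χ m ℤ.* κ n ℤ.+ κ m ℤ.* χ n      ≡⟨ cong₂ (λ i j → χ m ℤ.* i ℤ.+ j ℤ.* χ n) κn≡0 κm≡0 ⟩
  χ m ℤ.* 0ℤ ℤ.+ 0ℤ ℤ.* χ n        ≡⟨ cong₂ ℤ._+_ (ℤₚ.*-zeroʳ (χ m)) (ℤₚ.*-zeroˡ (χ n)) ⟩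
  0ℤ                               ∎
  where open ≡-Reasoning

χ≡0-*ʳ : ∀ m n → χ n ≡ 0ℤ → χ (m * n) ≡ 0ℤ
χ≡0-*ʳ zero    n χn≡0 = refl
χ≡0-*ʳ (suc m) n χn≡0 = χ≡0-+ n (m * n) χn≡0 (χ≡0-*ʳ m n χn≡0)

χ≡0-*ˡ : ∀ m n → χ m ≡ 0ℤ → χ (m * n) ≡ 0ℤ
χ≡0-*ˡ m n χm≡0 = trans (cong χ (ℕₚ.*-comm m n)) (χ≡0-*ʳ n m χm≡0)

-- Joint induction on `m`: for odd `n` the addition formulas lose their `κ n` terms, and the square
-- of `χ n` is 1.
χ-* : ∀ m n → κ n ≡ 0ℤ → χ (m * n) ≡ χ m ℤ.* χ n
κ-* : ∀ m n → κ n ≡ 0ℤ → κ (m * n) ≡ κ m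
χ-* zero    n κn≡0 = refl
χ-* (suc m) n κn≡0 = begin
  χ (n + m * n)                                ≡⟨ χ-+ n (m * n) ⟩
  χ n ℤ.* κ (m * n) ℤ.+ κ n ℤ.* χ (m * n)      ≡⟨ cong₂ (λ i j → χ n ℤ.* i ℤ.+ j ℤ.* χ (m * n)) (κ-* m n κn≡0) κn≡0 ⟩
  χ n ℤ.* κ m ℤ.+ 0ℤ ℤ.* χ (m * n)             ≡⟨ drop-zero (χ n) (κ m) (χ (m * n)) ⟩
  κ m ℤ.* χ n                                  ∎
  where
  open ≡-Reasoning
  drop-zero : ∀ i j k → i ℤ.* j ℤ.+ 0ℤ ℤ.* k ≡ j ℤ.* i
  drop-zero = solve-∀
κ-* zero    n κn≡0 = refl
κ-* (suc m) n κn≡0 = begin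
  κ (n + m * n)                                ≡⟨ κ-+ n (m * n) ⟩
  κ n ℤ.* κ (m * n) ℤ.- χ n ℤ.* χ (m * n)      ≡⟨ cong₂ (λ i j → i ℤ.* κ (m * n) ℤ.- χ n ℤ.* j) κn≡0 (χ-* m n κn≡0) ⟩
  0ℤ ℤ.* κ (m * n) ℤ.- χ n ℤ.* (χ m ℤ.* χ n)   ≡⟨ regroup (κ (m * n)) (χ n) (χ m) ⟩
  ℤ.- (χ m ℤ.* (χ n ℤ.* χ n))                  ≡⟨ cong (λ i → ℤ.- (χ m ℤ.* i)) (κ≡0⇒χ²≡1 n κn≡0) ⟩
  ℤ.- (χ m ℤ.* 1ℤ)                             ≡⟨ cong ℤ.-_ (ℤₚ.*-identityʳ (χ m)) ⟩
  ℤ.- χ m                                      ∎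
  where
  open ≡-Reasoning
  regroup : ∀ i j k → 0ℤ ℤ.* i ℤ.- j ℤ.* (k ℤ.* j) ≡ ℤ.- (k ℤ.* (j ℤ.* j))
  regroup = solve-∀

-- χ and κ are shifts of each other, so the partial sums of κ telescope.
∑-1-2κ : ∀ m → ∑ (downFrom m) (λ i → 1ℤ ℤ.- (+ 2) ℤ.* κ (suc i)) ≡ + suc m ℤ.- χ (suc m) ℤ.+ κ (suc m)
∑-1-2κ zero    = refl
∑-1-2κ (suc m) = trans (+-congˡ (1ℤ ℤ.- (+ 2) ℤ.* κ (suc m)) (∑-1-2κ m)) (telescope (χ m) (κ m) (+ suc m))
  where
  telescope : ∀ i j k → 1ℤ ℤ.- (+ 2) ℤ.* (ℤ.- i) ℤ.+ (k ℤ.- j ℤ.+ (ℤ.- i)) ≡ (1ℤ ℤ.+ k) ℤ.- (ℤ.- i) ℤ.+ (ℤ.- j)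
  telescope = solve-∀

2*suc+1 : ∀ r → 2 * suc r + 1 ≡ suc (suc (2 * r + 1))
2*suc+1 = ℕ-solver.solve-∀

χ-odd : ∀ r → χ (2 * r + 1) ≡ -1ℤ ℤ.^ r
χ-odd zero    = refl
χ-odd (suc r) = trans (cong χ (2*suc+1 r)) (trans (cong ℤ.-_ (χ-odd r)) (sym (ℤₚ.-1*i≡-i (-1ℤ ℤ.^ r))))

κ-odd : ∀ r → κ (2 * r + 1) ≡ 0ℤ
κ-odd zero    = refl
κ-odd (suc r) = trans (cong κ (2*suc+1 r)) (cong ℤ.-_ (κ-odd r))

⌊odd/2⌋ : ∀ r → ⌊ 2 * r + 1 /2⌋ ≡ r
⌊odd/2⌋ zero    = refl
⌊odd/2⌋ (suc r) = trans (cong ⌊_/2⌋ (2*suc+1 r)) (cong suc (⌊odd/2⌋ r))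

κ≡0⇒odd : ∀ m → κ m ≡ 0ℤ → 2 * ⌊ m /2⌋ + 1 ≡ m
κ≡0⇒odd zero          ()
κ≡0⇒odd (suc zero)    _    = refl
-- Two steps negate `κ`, so negating the hypothesis once more gives it for `m`.
κ≡0⇒odd (suc (suc m)) κ≡0 = trans (2*suc+1 ⌊ m /2⌋)
  (cong (suc ∘ suc) (κ≡0⇒odd m (trans (sym (ℤₚ.neg-involutive (κ m))) (cong ℤ.-_ κ≡0))))

-- Solutions of k x + l y = n

-- Here a Quadruple is (k , l , x , y), with the multiplicities k and l
-- themselves rather than r₁ and r₂, and without the constraint x < y.

Solution : ℕ → Quadruple → Set
Solution n (k , l , x , y) = (1 ≤ k × 1 ≤ l × 1 ≤ x × 1 ≤ y) × k * x + l * y ≡ n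

solution? : ∀ n → Decidable (Solution n)
solution? n (k , l , x , y) =
  ((1 ≤? k) ×-dec (1 ≤? l) ×-dec (1 ≤? x) ×-dec (1 ≤? y)) ×-dec (k * x + l * y ≟ n)

factorˡ≤ : ∀ {m n} → 1 ≤ n → m ≤ m * n
factorˡ≤ {m} {n} 1≤n = ℕₚ.m≤m*n m n {{>-nonZero 1≤n}}

factorʳ≤ : ∀ {m n} → 1 ≤ m → n ≤ m * n
factorʳ≤ {m} {n} 1≤m = ℕₚ.m≤n*m n m {{>-nonZero 1≤m}}

-- As all entries are positive, each is at most the product it occurs in and so at most `n`: the box
-- of side `suc n` contains every solution.
solutions : ∀ n → Enumeration (Solution n)
solutions n = reindex (restrict (product I (product I (product I I))) (solution? n)) proj₂ bounded
  where
  I = below (suc n)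
  bounded : ∀ {q} → Solution n q → _
  bounded {k , l , x , y} s@((1≤k , 1≤l , 1≤x , 1≤y) , refl) =
    ( s≤s (ℕₚ.≤-trans (factorˡ≤ 1≤x) (ℕₚ.m≤m+n (k * x) (l * y)))
    , s≤s (ℕₚ.≤-trans (factorˡ≤ 1≤y) (ℕₚ.m≤n+m (l * y) (k * x)))
    , s≤s (ℕₚ.≤-trans (factorʳ≤ 1≤k) (ℕₚ.m≤m+n (k * x) (l * y)))
    , s≤s (ℕₚ.≤-trans (factorʳ≤ 1≤l) (ℕₚ.m≤n+m (l * y) (k * x))) ) , s

admissibles : ∀ n → Enumeration (Admissible n)
admissibles n .list          = quadruples n
admissibles n .unique        = quadruples-unique n
admissibles n .sound {q}     = Equivalence.to (∈-quadruples n q)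
admissibles n .complete {q}  = Equivalence.from (∈-quadruples n q)

-- Symmetries of the solution set and Liouville's shear

swap transpose shear unshear : Quadruple → Quadruple
swap      (k , l , x , y) = l , k , y , x
transpose (k , l , x , y) = x , y , k , l
shear     (k , l , x , y) = k + l , l , x , y ∸ x
unshear   (k , l , x , y) = k ∸ l , l , x , x + y

x<y x≡y y<x l<k k≡l k<l : ∀ n → Enumeration _
x<y n = restrict (solutions n) (λ (k , l , x , y) → x <? y)
x≡y n = restrict (solutions n) (λ (k , l , x , y) → x ≟ y)
y<x n = restrict (solutions n) (λ (k , l , x , y) → y <? x)
l<k n = restrict (solutions n) (λ (k , l , x , y) → l <? k)
k≡l n = restrict (solutions n) (λ (k , l , x , y) → k ≟ l)
k<l n = restrict (solutions n) (λ (k , l , x , y) → k <? l)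

∑-split-parts : ∀ n w →
  ∑ (solutions n .list) w ≡ ∑ (x<y n .list) w ℤ.+ ∑ (x≡y n .list) w ℤ.+ ∑ (y<x n .list) w
∑-split-parts n = ∑-trichotomy _ _ _ (λ (k , l , x , y) → ℕₚ.<-cmp x y) (solutions n .list)

∑-split-multiplicities : ∀ n w →
  ∑ (solutions n .list) w ≡ ∑ (k<l n .list) w ℤ.+ ∑ (k≡l n .list) w ℤ.+ ∑ (l<k n .list) w
∑-split-multiplicities n = ∑-trichotomy _ _ _ (λ (k , l , x , y) → ℕₚ.<-cmp k l) (solutions n .list)

solution-swap : ∀ {n} q → Solution n q → Solution n (swap q)
solution-swap (k , l , x , y) ((1≤k , 1≤l , 1≤x , 1≤y) , eq) =
  (1≤l , 1≤k , 1≤y , 1≤x) , trans (ℕₚ.+-comm (l * y) (k * x)) eq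

solution-transpose : ∀ {n} q → Solution n q → Solution n (transpose q)
solution-transpose (k , l , x , y) ((1≤k , 1≤l , 1≤x , 1≤y) , eq) =
  (1≤x , 1≤y , 1≤k , 1≤l) , trans (cong₂ _+_ (ℕₚ.*-comm x k) (ℕₚ.*-comm y l)) eq

∑-swap-parts : ∀ n w → ∑ (x<y n .list) (w ∘ swap) ≡ ∑ (y<x n .list) w
∑-swap-parts n = ∑-bijection (x<y n) (y<x n) swap swap
  (λ q (s , lt) → (solution-swap q s , lt) , refl) (λ q (s , lt) → (solution-swap q s , lt) , refl)

∑-swap-multiplicities : ∀ n w → ∑ (l<k n .list) (w ∘ swap) ≡ ∑ (k<l n .list) w
∑-swap-multiplicities n = ∑-bijection (l<k n) (k<l n) swap swap
  (λ q (s , lt) → (solution-swap q s , lt) , refl) (λ q (s , lt) → (solution-swap q s , lt) , refl)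

∑-transpose : ∀ n w → ∑ (x≡y n .list) (w ∘ transpose) ≡ ∑ (k≡l n .list) w
∑-transpose n = ∑-bijection (x≡y n) (k≡l n) transpose transpose
  (λ q (s , eq) → (solution-transpose q s , eq) , refl) (λ q (s , eq) → (solution-transpose q s , eq) , refl)

-- Matching on the equation replaces `n` by `m + o`, after which truncated subtractions of `m`
-- cancel exactly.
<⇒gap : ∀ {m n} → m < n → ∃ λ o → 1 ≤ o × m + o ≡ n
<⇒gap {m} {n} m<n = n ∸ m , ℕₚ.m<n⇒0<n∸m m<n , ℕₚ.m+[n∸m]≡n (ℕₚ.<⇒≤ m<n)

-- The equation survives because k x + l y = (k + l) x + l (y - x). The conditions trade places: x <
-- y becomes positivity of the new y, and positivity of k becomes l < k for the new k.
∑-shear : ∀ n w → ∑ (x<y n .list) (w ∘ shear) ≡ ∑ (l<k n .list) w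
∑-shear n = ∑-bijection (x<y n) (l<k n) shear unshear to from
  where
  exchange : ∀ k l x z → (k + l) * x + l * z ≡ k * x + l * (x + z)
  exchange = ℕ-solver.solve-∀

  to : ∀ q → _ → _
  to (k , l , x , y) (((1≤k , 1≤l , 1≤x , 1≤y) , eq) , lt) with <⇒gap lt
  ... | z , 1≤z , refl rewrite ℕₚ.m+n∸m≡n x z | ℕₚ.m+n∸n≡m k l =
    (((ℕₚ.≤-trans 1≤k (ℕₚ.m≤m+n k l) , 1≤l , 1≤x , 1≤z) , trans (exchange k l x z) eq) , ℕₚ.m<n+m l 1≤k) , refl

  from : ∀ q → _ → _
  from (k , l , x , y) (((1≤k , 1≤l , 1≤x , 1≤y) , eq) , lt) with <⇒gap lt
  -- Shearing back yields `m + l` where the given quadruple has `l + m`, hence the last rewrite.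
  ... | m , 1≤m , refl rewrite ℕₚ.m+n∸m≡n l m | ℕₚ.m+n∸m≡n x y | ℕₚ.+-comm l m =
    (((1≤m , 1≤l , 1≤x , ℕₚ.≤-trans 1≤x (ℕₚ.m≤m+n x y)) , trans (sym (exchange m l x y)) eq) , ℕₚ.m<m+n x 1≤y) , refl

-- Factorizations d x = n

Factorization : ℕ → ℕ × ℕ → Set
Factorization n (d , x) = (1 ≤ d × 1 ≤ x) × d * x ≡ n

factorizations : ∀ n → Enumeration (Factorization n)
factorizations n = reindex (restrict (product (below (suc n)) (below (suc n))) factorization?) proj₂ bounded
  where
  factorization? : Decidable (Factorization n)
  factorization? (d , x) = ((1 ≤? d) ×-dec (1 ≤? x)) ×-dec (d * x ≟ n)

  bounded : ∀ {q} → Factorization n q → _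
  bounded {d , x} f@((1≤d , 1≤x) , refl) = (s≤s (factorˡ≤ 1≤x) , s≤s (factorʳ≤ 1≤d)) , f

∑-factorizations-swap : ∀ n (w : ℕ × ℕ → ℤ) →
  ∑ (factorizations n .list) (λ (d , x) → w (x , d)) ≡ ∑ (factorizations n .list) w
∑-factorizations-swap n = ∑-bijection (factorizations n) (factorizations n) flip flip involutive involutive
  where
  flip : ℕ × ℕ → ℕ × ℕ
  flip (d , x) = x , d
  involutive : ∀ q → Factorization n q → Factorization n (flip q) × flip (flip q) ≡ q
  involutive (d , x) ((1≤d , 1≤x) , eq) = ((1≤x , 1≤d) , trans (ℕₚ.*-comm x d) eq) , refl

-- For x = y the equation reads (k + l) x = n: such a solution is a factorization d x = n with a
-- choice of k from 1 to d - 1, where l = d - k.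
∑-x≡y : ∀ n (v : ℕ → ℤ) → ∑ (x≡y n .list) (λ (k , _) → v k) ≡
  ∑ (factorizations n .list) (λ (d , _) → ∑ (downFrom (pred d)) (v ∘ suc))
∑-x≡y n v = begin
  ∑ (x≡y n .list) (λ (k , _) → v k)
    ≡⟨ ∑-bijection triples (x≡y n) f g to from (λ (k , _) → v k) ⟨
  ∑ (triples .list) (λ (_ , i) → v (suc i))
    ≡⟨ ∑-filter-cartesianProduct (λ ((d , x) , i) → suc i <? d) (factorizations n .list) (downFrom n) _ ⟩
  ∑ (factorizations n .list) (λ (d , x) → ∑ (filter (λ i → suc i <? d) (downFrom n)) (v ∘ suc))
    ≡⟨ ∑-cong (factorizations n .list) (λ {(d , x)} q∈ → inner d x (factorizations n .sound q∈)) ⟩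
  ∑ (factorizations n .list) (λ (d , _) → ∑ (downFrom (pred d)) (v ∘ suc))
    ∎
  where
  open ≡-Reasoning
  -- The index `i` stands for k - 1, and `suc i < d` leaves l positive. All factorizations share the
  -- range `i < n`, so that a plain product can be filtered.
  triples = restrict (product (factorizations n) (below n)) (λ ((d , x) , i) → suc i <? d)

  f : (ℕ × ℕ) × ℕ → Quadruple
  f ((d , x) , i) = suc i , d ∸ suc i , x , x

  g : Quadruple → (ℕ × ℕ) × ℕ
  g (k , l , x , _) = (k + l , x) , pred k

  to : ∀ t → _ → _
  to ((d , x) , i) ((((1≤d , 1≤x) , eq) , i<n) , i<d) with <⇒gap i<d
  ... | l , 1≤l , refl rewrite ℕₚ.m+n∸m≡n i l =
    (((s≤s z≤n , 1≤l , 1≤x , 1≤x) , trans (sym (ℕₚ.*-distribʳ-+ x (suc i) l)) eq) , refl) , refl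

  from : ∀ q → _ → _
  from (suc i , l , x , _) (((_ , 1≤l , 1≤x , _) , eq) , refl) rewrite ℕₚ.m+n∸m≡n i l =
    ((((s≤s z≤n , 1≤x) , d*x≡n) , i<n) , ℕₚ.m<m+n (suc i) 1≤l) , refl
    where
    d*x≡n : (suc i + l) * x ≡ n
    d*x≡n = trans (ℕₚ.*-distribʳ-+ x (suc i) l) eq
    i<n : i < n
    i<n = ℕₚ.≤-trans (s≤s (ℕₚ.m≤m+n i l)) (ℕₚ.≤-trans (factorˡ≤ 1≤x) (ℕₚ.≤-reflexive d*x≡n))

  inner : ∀ d x → Factorization n (d , x) →
    ∑ (filter (λ i → suc i <? d) (downFrom n)) (v ∘ suc) ≡ ∑ (downFrom (pred d)) (v ∘ suc)
  -- The common bound `i < n` excludes nothing here, because d is at most d x = n.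
  inner (suc m) x ((_ , 1≤x) , refl) = ∑-bijection
    (restrict (below n) (λ i → suc i <? suc m)) (below m) id id
    (λ { i (_ , s≤s i<m) → i<m , refl })
    (λ i i<m → (ℕₚ.≤-trans (ℕₚ.m≤n⇒m≤1+n i<m) (factorˡ≤ 1≤x) , s≤s i<m) , refl)
    (v ∘ suc)

-- The weight χ(k)χ(l) and its relation to a(n)

weight : Quadruple → ℤ
weight (k , l , _) = χ k ℤ.* χ l

weight-swap : ∀ q → weight q ≡ weight (swap q)
weight-swap (k , l , _) = ℤₚ.*-comm (χ k) (χ l)

weight≡0⊎odd : ∀ k l → χ k ℤ.* χ l ≡ 0ℤ ⊎ (κ k ≡ 0ℤ × κ l ≡ 0ℤ)
weight≡0⊎odd k l with χ≡0⊎κ≡0 k | χ≡0⊎κ≡0 l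
... | inj₁ χk≡0 | _         = inj₁ (cong (ℤ._* χ l) χk≡0)
... | _         | inj₁ χl≡0 = inj₁ (trans (cong (χ k ℤ.*_) χl≡0) (ℤₚ.*-zeroʳ (χ k)))
... | inj₂ κk≡0 | inj₂ κl≡0 = inj₂ (κk≡0 , κl≡0)

-- For k = 2 r₁ + 1 and l = 2 r₂ + 1 the weight is the sign. An even multiplicity gives weight zero,
-- so the sum may run over all solutions with x < y.
a≡∑-x<y : ∀ n → a n ≡ ∑ (x<y n .list) weight
a≡∑-x<y n = begin
  ∑ (quadruples n) sign          ≡⟨ ∑-cong (quadruples n) (λ {q} _ → sign≡weight q) ⟩
  ∑ (quadruples n) (weight ∘ f)  ≡⟨ ∑-bijection (admissibles n) odd f g to from weight ⟩
  ∑ (odd .list) weight           ≡⟨ ∑-filter-restrict odd? (x<y n .list) even⇒weight≡0 ⟨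
  ∑ (x<y n .list) weight         ∎
  where
  open ≡-Reasoning
  f g : Quadruple → Quadruple
  f (x , y , r₁ , r₂) = 2 * r₁ + 1 , 2 * r₂ + 1 , x , y
  g (k , l , x , y)   = x , y , ⌊ k /2⌋ , ⌊ l /2⌋

  odd? : Decidable (λ (k , l , _) → κ k ≡ 0ℤ × κ l ≡ 0ℤ)
  odd? (k , l , _) = (κ k ℤ.≟ 0ℤ) ×-dec (κ l ℤ.≟ 0ℤ)
  odd = restrict (x<y n) odd?

  even⇒weight≡0 : ∀ q → ¬ _ → weight q ≡ 0ℤ
  even⇒weight≡0 (k , l , _) ¬odd = [ id , (λ o → ⊥-elim (¬odd o)) ]′ (weight≡0⊎odd k l)

  sign≡weight : ∀ q → sign q ≡ weight (f q)
  sign≡weight (x , y , r₁ , r₂) =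
    trans (ℤₚ.^-distribˡ-+-* -1ℤ r₁ r₂) (sym (cong₂ ℤ._*_ (χ-odd r₁) (χ-odd r₂)))

  to : ∀ q → _ → _
  to (x , y , r₁ , r₂) (1≤x , lt , eq) =
    (((( ℕₚ.m≤n+m 1 (2 * r₁) , ℕₚ.m≤n+m 1 (2 * r₂) , 1≤x , ℕₚ.≤-trans 1≤x (ℕₚ.<⇒≤ lt)) , eq) , lt)
    , κ-odd r₁ , κ-odd r₂) , cong₂ (λ r s → x , y , r , s) (⌊odd/2⌋ r₁) (⌊odd/2⌋ r₂)

  from : ∀ q → _ → _
  from (k , l , x , y) ((((_ , _ , 1≤x , _) , eq) , lt) , κk≡0 , κl≡0) =
    (1≤x , lt , trans (cong₂ (λ i j → i * x + j * y) k-odd l-odd) eq)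
    , cong₂ (λ i j → i , j , x , y) k-odd l-odd
    where
    k-odd = κ≡0⇒odd k κk≡0
    l-odd = κ≡0⇒odd l κl≡0

-- Liouville-type identities for odd `n`

module _ {n : ℕ} (n-odd : ¬ χ n ≡ 0ℤ) where

  factor-odd : ∀ d {x} → d * x ≡ n → κ d ≡ 0ℤ
  factor-odd d {x} refl = [ (λ χd≡0 → ⊥-elim (n-odd (χ≡0-*ˡ d x χd≡0))) , id ]′ (χ≡0⊎κ≡0 d)

  not-both-even : ∀ k l x y → Solution n (k , l , x , y) → κ k ≡ 0ℤ ⊎ κ l ≡ 0ℤ
  not-both-even k l x y (_ , refl) with χ≡0⊎κ≡0 k | χ≡0⊎κ≡0 l
  ... | inj₂ κk≡0 | _         = inj₁ κk≡0
  ... | _         | inj₂ κl≡0 = inj₂ κl≡0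
  ... | inj₁ χk≡0 | inj₁ χl≡0 =
    ⊥-elim (n-odd (χ≡0-+ (k * x) (l * y) (χ≡0-*ˡ k x χk≡0) (χ≡0-*ˡ l y χl≡0)))

  -- Equal multiplicities give k (x + y) = n, and every factor of an odd number is odd.
  k≡l-odd : ∀ k l x y → Solution n (k , l , x , y) → k ≡ l → κ k ≡ 0ℤ
  k≡l-odd k .k x y (_ , eq) refl = factor-odd k (trans (ℕₚ.*-distribˡ-+ k x y) eq)

  -- With x = y the equation is (k + l) x = n, so k + l is odd and one of the two multiplicities is
  -- even, which kills the weight.
  ∑-x≡y-weight : ∑ (x≡y n .list) weight ≡ 0ℤ
  ∑-x≡y-weight = ∑-0 (x≡y n .list) (λ {q} q∈ → zero-weight q (x≡y n .sound q∈))
    where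
    zero-weight : ∀ q → _ → weight q ≡ 0ℤ
    zero-weight (k , l , x , _) ((_ , eq) , refl) with weight≡0⊎odd k l
    ... | inj₁ w≡0           = w≡0
    ... | inj₂ (κk≡0 , κl≡0) = ⊥-elim (n-odd (begin
      χ n                ≡⟨ cong χ eq ⟨
      χ (k * x + l * x)  ≡⟨ cong χ (ℕₚ.*-distribʳ-+ x k l) ⟨
      χ ((k + l) * x)    ≡⟨ χ≡0-*ˡ (k + l) x (κ≡0-+ k l κk≡0 κl≡0) ⟩
      0ℤ                 ∎))
      where open ≡-Reasoning

  -- χ k χ l = - κ (k + l) unless k and l are both even.
  ∑-x<y-weight : ∑ (x<y n .list) weight ≡ -1ℤ ℤ.* ∑ (l<k n .list) (λ (k , _) → κ k)
  ∑-x<y-weight = begin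
    ∑ (x<y n .list) weight
      ≡⟨ ∑-cong (x<y n .list) (λ {q} q∈ → pointwise q (proj₁ (x<y n .sound q∈))) ⟩
    ∑ (x<y n .list) ((λ (k , _) → -1ℤ ℤ.* κ k) ∘ shear)
      ≡⟨ ∑-shear n _ ⟩
    ∑ (l<k n .list) (λ (k , _) → -1ℤ ℤ.* κ k)
      ≡⟨ ∑-distrib-* (l<k n .list) -1ℤ _ ⟩
    -1ℤ ℤ.* ∑ (l<k n .list) (λ (k , _) → κ k)
      ∎
    where
    open ≡-Reasoning
    expand : ∀ i j → i ≡ 0ℤ → j ≡ -1ℤ ℤ.* (i ℤ.- j)
    expand .0ℤ j refl = solve-0 j
      where
      solve-0 : ∀ j → j ≡ -1ℤ ℤ.* (0ℤ ℤ.- j)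
      solve-0 = solve-∀

    κκ≡0 : ∀ k l → κ k ≡ 0ℤ ⊎ κ l ≡ 0ℤ → κ k ℤ.* κ l ≡ 0ℤ
    κκ≡0 k l (inj₁ κk≡0) = cong (ℤ._* κ l) κk≡0
    κκ≡0 k l (inj₂ κl≡0) = trans (cong (κ k ℤ.*_) κl≡0) (ℤₚ.*-zeroʳ (κ k))

    pointwise : ∀ q → Solution n q → weight q ≡ -1ℤ ℤ.* κ (proj₁ (shear q))
    pointwise (k , l , x , y) s = trans
      (expand (κ k ℤ.* κ l) (χ k ℤ.* χ l) (κκ≡0 k l (not-both-even k l x y s)))
      (cong (-1ℤ ℤ.*_) (sym (κ-+ k l)))

  -- χ (k + l) χ l = κ k unless k and l are both even.
  ∑-l<k-weight : ∑ (l<k n .list) weight ≡ ∑ (x<y n .list) (λ (k , _) → κ k)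
  ∑-l<k-weight = begin
    ∑ (l<k n .list) weight
      ≡⟨ ∑-shear n weight ⟨
    ∑ (x<y n .list) (weight ∘ shear)
      ≡⟨ ∑-cong (x<y n .list) (λ {q} q∈ → pointwise q (proj₁ (x<y n .sound q∈))) ⟩
    ∑ (x<y n .list) (λ (k , _) → κ k)
      ∎
    where
    open ≡-Reasoning
    regroup : ∀ i j k l → (i ℤ.* l ℤ.+ j ℤ.* k) ℤ.* k ≡ i ℤ.* (k ℤ.* l) ℤ.+ j ℤ.* (k ℤ.* k)
    regroup = solve-∀

    κχ²≡κ : ∀ k l → κ k ≡ 0ℤ ⊎ κ l ≡ 0ℤ → κ k ℤ.* (χ l ℤ.* χ l) ≡ κ k
    κχ²≡κ k l (inj₁ κk≡0) = trans (cong (ℤ._* (χ l ℤ.* χ l)) κk≡0) (sym κk≡0)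
    κχ²≡κ k l (inj₂ κl≡0) = trans (cong (κ k ℤ.*_) (κ≡0⇒χ²≡1 l κl≡0)) (ℤₚ.*-identityʳ (κ k))

    pointwise : ∀ q → Solution n q → weight (shear q) ≡ κ (proj₁ q)
    pointwise (k , l , x , y) s = begin
      χ (k + l) ℤ.* χ l
        ≡⟨ cong (ℤ._* χ l) (χ-+ k l) ⟩
      (χ k ℤ.* κ l ℤ.+ κ k ℤ.* χ l) ℤ.* χ l
        ≡⟨ regroup (χ k) (κ k) (χ l) (κ l) ⟩
      χ k ℤ.* (χ l ℤ.* κ l) ℤ.+ κ k ℤ.* (χ l ℤ.* χ l)
        ≡⟨ cong₂ ℤ._+_
             (trans (cong (χ k ℤ.*_) (χκ≡0 l)) (ℤₚ.*-zeroʳ (χ k)))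
             (κχ²≡κ k l (not-both-even k l x y s)) ⟩
      0ℤ ℤ.+ κ k
        ≡⟨ ℤₚ.+-identityˡ (κ k) ⟩
      κ k
        ∎

  ∑-k≡l-κ : ∑ (k≡l n .list) (λ (k , _) → κ k) ≡ 0ℤ
  ∑-k≡l-κ = ∑-0 (k≡l n .list)
    (λ { {k , l , x , y} q∈ → let s , eq = k≡l n .sound q∈ in k≡l-odd k l x y s eq })

  -- A swap moves `κ` onto l, which the shear leaves fixed; a second swap moves it back onto k.
  ∑-y<x-κ : ∑ (y<x n .list) (λ (k , _) → κ k) ≡ ∑ (k<l n .list) (λ (k , _) → κ k)
  ∑-y<x-κ = begin
    ∑ (y<x n .list) (λ (k , _) → κ k)      ≡⟨ ∑-swap-parts n _ ⟨
    ∑ (x<y n .list) (λ (_ , l , _) → κ l)  ≡⟨ ∑-shear n (λ (_ , l , _) → κ l) ⟩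
    ∑ (l<k n .list) (λ (_ , l , _) → κ l)  ≡⟨ ∑-swap-multiplicities n _ ⟩
    ∑ (k<l n .list) (λ (k , _) → κ k)      ∎
    where open ≡-Reasoning

  -- On this diagonal k is odd, so the weight is a square equal to 1. Transposing brings the count
  -- to the diagonal x = y, where the `κ` sum also lives.
  ∑-k≡l-weight : ∑ (k≡l n .list) weight ≡ ∑ (x≡y n .list) (λ _ → 1ℤ)
  ∑-k≡l-weight = trans
    (∑-cong (k≡l n .list) (λ {q} q∈ → pointwise q (k≡l n .sound q∈)))
    (sym (∑-transpose n (λ _ → 1ℤ)))
    where
    pointwise : ∀ q → _ → weight q ≡ 1ℤ
    pointwise (k , .k , x , y) (s , refl) = κ≡0⇒χ²≡1 k (k≡l-odd k k x y s refl)

  -- `swap` preserves the weight, so x < y and y < x contribute equally, and the diagonal x = y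
  -- contributes nothing.
  ∑-symmetric-parts : ∑ (solutions n .list) weight ≡ (+ 2) ℤ.* ∑ (x<y n .list) weight
  ∑-symmetric-parts = begin
    ∑ (solutions n .list) weight                  ≡⟨ ∑-split-parts n weight ⟩
    X ℤ.+ ∑ (x≡y n .list) weight ℤ.+ ∑ (y<x n .list) weight
      ≡⟨ cong₂ (λ i j → X ℤ.+ i ℤ.+ j) ∑-x≡y-weight (sym swapped) ⟩
    X ℤ.+ 0ℤ ℤ.+ X                                ≡⟨ double X ⟩
    (+ 2) ℤ.* X                                   ∎
    where
    open ≡-Reasoning
    X = ∑ (x<y n .list) weight
    swapped : X ≡ ∑ (y<x n .list) weight
    swapped = trans (∑-cong (x<y n .list) (λ {q} _ → weight-swap q)) (∑-swap-parts n weight)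
    double : ∀ i → i ℤ.+ 0ℤ ℤ.+ i ≡ (+ 2) ℤ.* i
    double = solve-∀

  -- The same reflection applied to k and l, except that the diagonal k = l survives.
  ∑-symmetric-multiplicities : ∑ (solutions n .list) weight ≡
    (+ 2) ℤ.* ∑ (l<k n .list) weight ℤ.+ ∑ (k≡l n .list) weight
  ∑-symmetric-multiplicities = begin
    ∑ (solutions n .list) weight      ≡⟨ ∑-split-multiplicities n weight ⟩
    ∑ (k<l n .list) weight ℤ.+ C ℤ.+ X
      ≡⟨ cong (λ i → i ℤ.+ C ℤ.+ X) (sym swapped) ⟩
    X ℤ.+ C ℤ.+ X                     ≡⟨ double X C ⟩
    (+ 2) ℤ.* X ℤ.+ C                 ∎
    where
    open ≡-Reasoning
    X = ∑ (l<k n .list) weight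
    C = ∑ (k≡l n .list) weight
    swapped : X ≡ ∑ (k<l n .list) weight
    swapped = trans (∑-cong (l<k n .list) (λ {q} _ → weight-swap q)) (∑-swap-multiplicities n weight)
    double : ∀ i j → i ℤ.+ j ℤ.+ i ≡ (+ 2) ℤ.* i ℤ.+ j
    double = solve-∀

  -- The sum of κ(k) over all solutions is split both ways. The part y < x of one splitting equals
  -- the part k < l of the other and cancels; the diagonal k = l vanishes.
  ∑-κ-exchange : ∑ (x<y n .list) (λ (k , _) → κ k) ℤ.+ ∑ (x≡y n .list) (λ (k , _) → κ k) ≡
    ∑ (l<k n .list) (λ (k , _) → κ k)
  ∑-κ-exchange = +-cancelʳ K _ _ (begin
    X ℤ.+ E ℤ.+ K      ≡⟨ +-congˡ (X ℤ.+ E) ∑-y<x-κ ⟨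
    X ℤ.+ E ℤ.+ ∑ (y<x n .list) φ  ≡⟨ ∑-split-parts n φ ⟨
    ∑ (solutions n .list) φ        ≡⟨ ∑-split-multiplicities n φ ⟩
    K ℤ.+ ∑ (k≡l n .list) φ ℤ.+ L  ≡⟨ cong (λ i → K ℤ.+ i ℤ.+ L) ∑-k≡l-κ ⟩
    K ℤ.+ 0ℤ ℤ.+ L                 ≡⟨ commute K L ⟩
    L ℤ.+ K                        ∎)
    where
    open ≡-Reasoning
    φ : Quadruple → ℤ
    φ (k , _) = κ k
    X = ∑ (x<y n .list) φ
    E = ∑ (x≡y n .list) φ
    K = ∑ (k<l n .list) φ
    L = ∑ (l<k n .list) φ
    commute : ∀ i j → i ℤ.+ 0ℤ ℤ.+ j ≡ j ℤ.+ i
    commute = solve-∀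

  4a≡∑-x≡y : (+ 4) ℤ.* a n ≡ ∑ (x≡y n .list) (λ (k , _) → 1ℤ ℤ.- (+ 2) ℤ.* κ k)
  4a≡∑-x≡y = begin
    (+ 4) ℤ.* a n                                 ≡⟨ cong ((+ 4) ℤ.*_) (a≡∑-x<y n) ⟩
    (+ 4) ℤ.* ∑ (x<y n .list) weight
      ≡⟨ eliminate _ _ (∑ (x<y n .list) φ) E _ C
           (trans (sym ∑-symmetric-parts) ∑-symmetric-multiplicities) ∑-x<y-weight ∑-l<k-weight ∑-κ-exchange ⟩
    C ℤ.+ ℤ.- (+ 2) ℤ.* E
      ≡⟨ cong₂ ℤ._+_ ∑-k≡l-weight (sym (∑-distrib-* (x≡y n .list) (ℤ.- (+ 2)) φ)) ⟩
    ∑ (x≡y n .list) (λ _ → 1ℤ) ℤ.+ ∑ (x≡y n .list) (λ q → ℤ.- (+ 2) ℤ.* φ q)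
      ≡⟨ ∑-distrib-+ (x≡y n .list) _ _ ⟨
    ∑ (x≡y n .list) (λ q → 1ℤ ℤ.+ ℤ.- (+ 2) ℤ.* φ q)
      ≡⟨ ∑-cong (x≡y n .list) (λ {q} _ → +-congˡ 1ℤ (sym (ℤₚ.neg-distribˡ-* (+ 2) (φ q)))) ⟩
    ∑ (x≡y n .list) (λ (k , _) → 1ℤ ℤ.- (+ 2) ℤ.* κ k) ∎
    where
    open ≡-Reasoning
    φ : Quadruple → ℤ
    φ (k , _) = κ k
    E = ∑ (x≡y n .list) φ
    C = ∑ (k≡l n .list) weight

    eliminate : ∀ A B X E L C → (+ 2) ℤ.* A ≡ (+ 2) ℤ.* B ℤ.+ C → A ≡ -1ℤ ℤ.* L → B ≡ X → X ℤ.+ E ≡ L →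
      (+ 4) ℤ.* A ≡ C ℤ.+ ℤ.- (+ 2) ℤ.* E
    eliminate A .X X E .(X ℤ.+ E) C 2A≡2X+C A≡-L refl refl = begin
      (+ 4) ℤ.* A                          ≡⟨ split A ⟩
      -- One copy of 2 A comes from the two splittings of the weight, the other from the shear, so
      -- that the terms in `X` cancel and only diagonals remain.
      (+ 2) ℤ.* A ℤ.+ (+ 2) ℤ.* A          ≡⟨ cong₂ (λ i j → i ℤ.+ (+ 2) ℤ.* j) 2A≡2X+C A≡-L ⟩
      ((+ 2) ℤ.* X ℤ.+ C) ℤ.+ (+ 2) ℤ.* (-1ℤ ℤ.* (X ℤ.+ E)) ≡⟨ cancel X C E ⟩
      C ℤ.+ ℤ.- (+ 2) ℤ.* E                ∎
      where
      split : ∀ i → (+ 4) ℤ.* i ≡ (+ 2) ℤ.* i ℤ.+ (+ 2) ℤ.* i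
      split = solve-∀
      cancel : ∀ i j k → ((+ 2) ℤ.* i ℤ.+ j) ℤ.+ (+ 2) ℤ.* (-1ℤ ℤ.* (i ℤ.+ k)) ≡ j ℤ.+ ℤ.- (+ 2) ℤ.* k
      cancel = solve-∀

  -- Grouped by d = k + l, the summands for k < d telescope.
  4a≡∑[d-χd] : (+ 4) ℤ.* a n ≡ ∑ (factorizations n .list) (λ (d , _) → + d ℤ.- χ d)
  4a≡∑[d-χd] = begin
    (+ 4) ℤ.* a n
      ≡⟨ 4a≡∑-x≡y ⟩
    ∑ (x≡y n .list) (λ (k , _) → 1ℤ ℤ.- (+ 2) ℤ.* κ k)
      ≡⟨ ∑-x≡y n (λ k → 1ℤ ℤ.- (+ 2) ℤ.* κ k) ⟩
    ∑ (factorizations n .list) (λ (d , _) → ∑ (downFrom (pred d)) (λ i → 1ℤ ℤ.- (+ 2) ℤ.* κ (suc i)))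
      ≡⟨ ∑-cong (factorizations n .list) (λ {(d , x)} q∈ → inner d x (factorizations n .sound q∈)) ⟩
    ∑ (factorizations n .list) (λ (d , _) → + d ℤ.- χ d)
      ∎
    where
    open ≡-Reasoning
    inner : ∀ d x → Factorization n (d , x) →
      ∑ (downFrom (pred d)) (λ i → 1ℤ ℤ.- (+ 2) ℤ.* κ (suc i)) ≡ + d ℤ.- χ d
    inner (suc m) x (_ , eq) = begin
      _                                       ≡⟨ ∑-1-2κ m ⟩
      -- The boundary term κ(d) vanishes because d divides the odd `n`.
      + suc m ℤ.- χ (suc m) ℤ.+ κ (suc m)     ≡⟨ +-congˡ (+ suc m ℤ.- χ (suc m)) (factor-odd (suc m) eq) ⟩
      + suc m ℤ.- χ (suc m) ℤ.+ 0ℤ            ≡⟨ ℤₚ.+-identityʳ _ ⟩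
      + suc m ℤ.- χ (suc m)                   ∎

-- Divisibility of the divisor sum by 3

χ-cofactors : ∀ d x → χ (d * x) ≡ -1ℤ → χ d ℤ.+ χ x ≡ 0ℤ
χ-cofactors d x χdx≡-1 = begin
  χ d ℤ.+ χ x                          ≡⟨ cong₂ ℤ._+_ (sym (ℤₚ.*-identityʳ (χ d))) refl ⟩
  -- The factor 1 becomes the square of `χ x`, so that χ(d)χ(x) = χ(d x) = -1 can be applied.
  χ d ℤ.* 1ℤ ℤ.+ χ x                   ≡⟨ cong (λ i → χ d ℤ.* i ℤ.+ χ x) (κ≡0⇒χ²≡1 x κx≡0) ⟨
  χ d ℤ.* (χ x ℤ.* χ x) ℤ.+ χ x        ≡⟨ regroup (χ d) (χ x) ⟩
  (χ d ℤ.* χ x) ℤ.* χ x ℤ.+ χ x        ≡⟨ cong (λ i → i ℤ.* χ x ℤ.+ χ x) (trans (sym (χ-* d x κx≡0)) χdx≡-1) ⟩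
  -1ℤ ℤ.* χ x ℤ.+ χ x                  ≡⟨ cancel (χ x) ⟩
  0ℤ                                   ∎
  where
  open ≡-Reasoning
  κx≡0 : κ x ≡ 0ℤ
  κx≡0 with χ≡0⊎κ≡0 x
  ... | inj₂ κ≡0 = κ≡0
  -- An even `x` would make χ(d x) zero.
  ... | inj₁ χ≡0 with () ← trans (sym χdx≡-1) (χ≡0-*ʳ d x χ≡0)
  regroup : ∀ i j → i ℤ.* (j ℤ.* j) ℤ.+ j ≡ (i ℤ.* j) ℤ.* j ℤ.+ j
  regroup = solve-∀
  cancel : ∀ i → -1ℤ ℤ.* i ℤ.+ i ≡ 0ℤ
  cancel = solve-∀

-- Modulo 3, d x ≡ -1 makes d a unit, which is its own inverse, so x ≡ -d. The cases are the
-- residues of `d`.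
3∣1+dx⇒3∣d+x : ∀ d x → 3 ℕ∣.∣ 1 + d * x → 3 ℕ∣.∣ d + x
3∣1+dx⇒3∣d+x d x 3∣ with d DivMod.divMod 3
... | DivMod.result q Fin.zero refl =
  ⊥-elim (3∤1 (ℕ∣.∣m+n∣m⇒∣n (subst (3 ℕ∣.∣_) (regroup q x) 3∣) (ℕ∣.m∣m*n (q * x))))
  where
  regroup : ∀ q x → 1 + (q * 3) * x ≡ 3 * (q * x) + 1
  regroup = ℕ-solver.solve-∀
  3∤1 : ¬ 3 ℕ∣.∣ 1
  3∤1 3∣1 with ℕ∣.∣⇒≤ 3∣1
  ... | s≤s ()
... | DivMod.result q (Fin.suc Fin.zero) refl = subst (3 ℕ∣.∣_) (regroup′ q x)
  (ℕ∣.∣m∣n⇒∣m+n (ℕ∣.m∣m*n q) (ℕ∣.∣m+n∣m⇒∣n (subst (3 ℕ∣.∣_) (regroup q x) 3∣) (ℕ∣.m∣m*n (q * x))))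
  where
  regroup : ∀ q x → 1 + (1 + q * 3) * x ≡ 3 * (q * x) + (1 + x)
  regroup = ℕ-solver.solve-∀
  regroup′ : ∀ q x → 3 * q + (1 + x) ≡ 1 + q * 3 + x
  regroup′ = ℕ-solver.solve-∀
-- For d = 2 + 3 q, doubling 1 + d x turns the coefficient of x into 4 ≡ 1, and adding 3 q completes
-- the constant 2 to d.
... | DivMod.result q (Fin.suc (Fin.suc Fin.zero)) refl = ℕ∣.∣m+n∣m⇒∣n
  (subst (3 ℕ∣.∣_) (regroup q x) (ℕ∣.∣m∣n⇒∣m+n (ℕ∣.∣m∣n⇒∣m+n 3∣ 3∣) (ℕ∣.m∣m*n q)))
  (ℕ∣.m∣m*n (2 * q * x + x))
  where
  regroup : ∀ q x → (1 + (2 + q * 3) * x) + (1 + (2 + q * 3) * x) + 3 * q ≡ 3 * (2 * q * x + x) + (2 + q * 3 + x)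
  regroup = ℕ-solver.solve-∀

-- Adding the sum `G` to its image under exchange of d and x gives 2 G with every summand divisible
-- by 3, without choosing one factorization from each pair. Then G = 3 G - 2 G.
3∣∑[d-χd] : ∀ n → χ n ≡ -1ℤ → 3 ℕ∣.∣ 1 + n →
  (+ 3) Signed.∣ ∑ (factorizations n .list) (λ (d , _) → + d ℤ.- χ d)
3∣∑[d-χd] n χn≡-1 3∣1+n = subst ((+ 3) Signed.∣_) (difference G)
  (Signed.∣m∣n⇒∣m-n (Signed.∣m⇒∣m*n G Signed.∣-refl) 3∣G+G)
  where
  g g′ : ℕ × ℕ → ℤ
  g (d , _)  = + d ℤ.- χ d
  g′ (_ , x) = + x ℤ.- χ x
  G = ∑ (factorizations n .list) g

  difference : ∀ i → (+ 3) ℤ.* i ℤ.- (i ℤ.+ i) ≡ i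
  difference = solve-∀

  pair : ∀ d x → Factorization n (d , x) → (+ 3) Signed.∣ g (d , x) ℤ.+ g′ (d , x)
  pair d x (_ , refl) = subst ((+ 3) Signed.∣_) (sym (begin
    (+ d ℤ.- χ d) ℤ.+ (+ x ℤ.- χ x)      ≡⟨ regroup (+ d) (χ d) (+ x) (χ x) ⟩
    (+ d ℤ.+ + x) ℤ.- (χ d ℤ.+ χ x)      ≡⟨ cong (λ i → (+ d ℤ.+ + x) ℤ.- i) (χ-cofactors d x χn≡-1) ⟩
    (+ d ℤ.+ + x) ℤ.- 0ℤ                 ≡⟨ ℤₚ.+-identityʳ _ ⟩
    + (d + x)                            ∎)) (Signed.∣ᵤ⇒∣ (3∣1+dx⇒3∣d+x d x 3∣1+n))
    where
    open ≡-Reasoning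
    regroup : ∀ i j k l → (i ℤ.- j) ℤ.+ (k ℤ.- l) ≡ (i ℤ.+ k) ℤ.- (j ℤ.+ l)
    regroup = solve-∀

  3∣G+G : (+ 3) Signed.∣ G ℤ.+ G
  3∣G+G = subst ((+ 3) Signed.∣_)
    (trans (∑-distrib-+ (factorizations n .list) g g′) (+-congˡ G (∑-factorizations-swap n g)))
    (∑-∣ (+ 3) (factorizations n .list) (λ {(d , x)} q∈ → pair d x (factorizations n .sound q∈)))

-- The residue class 11 modulo 12

χ[12n+11]≡-1 : ∀ n → χ (12 * n + 11) ≡ -1ℤ
χ[12n+11]≡-1 zero    = refl
χ[12n+11]≡-1 (suc n) = begin
  χ (12 * suc n + 11)                           ≡⟨ cong χ (shift n) ⟩
  χ (12 + (12 * n + 11))                        ≡⟨ χ-+ 12 (12 * n + 11) ⟩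
  -- A shift by 12 is three full periods: `χ 12` and `κ 12` evaluate to 0 and 1.
  0ℤ ℤ.* κ (12 * n + 11) ℤ.+ 1ℤ ℤ.* χ (12 * n + 11)  ≡⟨ drop-zero (κ (12 * n + 11)) (χ (12 * n + 11)) ⟩
  χ (12 * n + 11)                               ≡⟨ χ[12n+11]≡-1 n ⟩
  -1ℤ                                           ∎
  where
  open ≡-Reasoning
  shift : ∀ n → 12 * suc n + 11 ≡ 12 + (12 * n + 11)
  shift = ℕ-solver.solve-∀
  drop-zero : ∀ i j → 0ℤ ℤ.* i ℤ.+ 1ℤ ℤ.* j ≡ j
  drop-zero = solve-∀

theorem1p6 : (n : ℕ) → (+ 3) ∣ a (12 * n + 11)
-- The factor 4 is removed through a = 4 a - 3 a.
theorem1p6 n = Signed.∣⇒∣ᵤ (subst ((+ 3) Signed.∣_) (difference (a N))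
  (Signed.∣m∣n⇒∣m-n 3∣4a (Signed.∣m⇒∣m*n (a N) Signed.∣-refl)))
  where
  N = 12 * n + 11

  N-odd : ¬ χ N ≡ 0ℤ
  N-odd χN≡0 with () ← trans (sym (χ[12n+11]≡-1 n)) χN≡0

  3∣1+N : 3 ℕ∣.∣ 1 + N
  3∣1+N = ℕ∣.divides (4 * n + 4) (regroup n)
    where
    regroup : ∀ n → 1 + (12 * n + 11) ≡ (4 * n + 4) * 3
    regroup = ℕ-solver.solve-∀

  3∣4a : (+ 3) Signed.∣ (+ 4) ℤ.* a N
  3∣4a = subst ((+ 3) Signed.∣_) (sym (4a≡∑[d-χd] {N} N-odd)) (3∣∑[d-χd] N (χ[12n+11]≡-1 n) 3∣1+N)

  difference : ∀ i → (+ 4) ℤ.* i ℤ.- (+ 3) ℤ.* i ≡ i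
  difference = solve-∀
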